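{- Let $z_1, z_2 \in \mathbb{R}_{>0}$ and let $(\Gamma_n)_{n\ge 1}$ be the sequence defined by $\Gamma_1 = z_1$, $\Gamma_2 = z_2$, and, for every integer $n \ge 3$, $$\Gamma_n = \Gamma_{\epsilon(n)}\cdot\prod_{k=1}^{\lceil n/2\rceil - 1} G(n-2k).$$ Then $(\Gamma_n)_{n\ge1}$ solves the recurrence $z_{n+2} = \frac{1}{z_{n+1}} + z_n$ with initial values $z_1, z_2$; that is, for every integer $n \ge 3$, $$\Gamma_n = \frac{1}{\Gamma_{n-1}} + \Gamma_{n-2}.$$
   Context: For an integer $n$, $\epsilon(n) = 2$ if $n$ is even and $\epsilon(n) = 1$ if $n$ is odd. For an integer $j \ge 1$, $G(j) = \dfrac{j + \Gamma_1\Gamma_2}{j - 1 + \Gamma_1\Gamma_2}$, where $\Gamma_1 = z_1$ and $\Gamma_2 = z_2$ are the given positive real numbers. -}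

module Defs where

open import Level using (_⊔_) renaming (suc to lsuc)
open import Algebra.Apartness.Bundles using (HeytingField; HeytingCommutativeRing)
open import Algebra.Bundles using (CommutativeRing)
open import Algebra.Definitions.RawMonoid using () renaming (_×_ to multiple; sum to fold)
import Algebra.Apartness.Properties.HeytingCommutativeRing as HCRProperties
import Algebra.Properties.Ring as RingProperties
open import Data.Fin.Base using (Fin; toℕ)
open import Data.Fin.Properties using (toℕ<n)
open import Data.Nat.Base as ℕ using (ℕ; zero; suc; NonZero; ⌈_/2⌉; parity)
import Data.Nat.Properties as ℕ
open import Data.Parity.Base using (0ℙ; 1ℙ)
open import Data.Product.Base using (_×_; _,_; proj₁; ∃-syntax)
open import Data.Sum.Base using (_⊎_; inj₁; inj₂)
open import Function.Bundles using (_⇔_; Equivalence)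
open import Relation.Binary.Core using (Rel)
open import Relation.Binary.PropositionalEquality.Core as ≡ using ()
open import Relation.Binary.Structures using (IsStrictPartialOrder)

-- The real numbers, characterised (up to isomorphism) as a Cauchy-complete
-- Archimedean ordered field.  Fields are Heyting fields: x # y is "x ≠ y" in
-- the positive sense, and exactly the elements apart from 0# are invertible.
-- Nontriviality 1# # 0# and, from it, 0# < 1# are consequences.
-- The inequality |x - y| < ε is spelled x < y + ε and y < x + ε.
record RealField c ℓ₁ ℓ₂ ℓ₃ : Set (lsuc (c ⊔ ℓ₁ ⊔ ℓ₂ ⊔ ℓ₃)) where
  field
    heytingField : HeytingField c ℓ₁ ℓ₂

  open HeytingField heytingField public

  infix 4 _<_
  field
    _<_                  : Rel Carrier ℓ₃
    isStrictPartialOrder : IsStrictPartialOrder _≈_ _<_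
    #⇔<⊎>                : ∀ {x y} → x # y ⇔ (x < y ⊎ y < x)
    +-monoˡ-<            : ∀ z {x y} → x < y → x + z < y + z
    *-pos                : ∀ {x y} → 0# < x → 0# < y → 0# < x * y

  open CommutativeRing (HeytingCommutativeRing.commutativeRing heytingCommutativeRing) public
    using (ring; +-rawMonoid; *-rawMonoid)

  fromℕ : ℕ → Carrier
  fromℕ n = multiple +-rawMonoid n 1#

  IsCauchy : (ℕ → Carrier) → Set (c ⊔ ℓ₃)
  IsCauchy s = ∀ ε → 0# < ε →
    ∃[ N ] (∀ m n → N ℕ.≤ m → N ℕ.≤ n → s m < s n + ε)

  _ConvergesTo_ : (ℕ → Carrier) → Carrier → Set (c ⊔ ℓ₃)
  s ConvergesTo x = ∀ ε → 0# < ε →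
    ∃[ N ] (∀ n → N ℕ.≤ n → (s n < x + ε) × (x < s n + ε))

  field
    archimedean : ∀ x → ∃[ n ] x < fromℕ n
    complete    : ∀ s → IsCauchy s → ∃[ x ] s ConvergesTo x

  -- #⇒invertible inverts the difference y - 0#, hence y.
  infixl 7 _/_⟨_⟩
  _/_⟨_⟩ : (x y : Carrier) → y # 0# → Carrier
  x / y ⟨ y#0 ⟩ = x * proj₁ (#⇒invertible y#0)

  ∏ : ∀ {n} → (Fin n → Carrier) → Carrier
  ∏ = fold *-rawMonoid

module _ {c ℓ₁ ℓ₂ ℓ₃} (R : RealField c ℓ₁ ℓ₂ ℓ₃) where
  open RealField R
  open IsStrictPartialOrder isStrictPartialOrder
    using (<-respʳ-≈; <-respˡ-≈) renaming (trans to <-trans)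
  open RingProperties ring using (-‿distribˡ-*; -‿distribʳ-*; -‿involutive)

  0<⇒#0 : ∀ {x} → 0# < x → x # 0#
  0<⇒#0 0<x = Equivalence.from #⇔<⊎> (inj₂ 0<x)

  0<1 : 0# < 1#
  0<1 with Equivalence.to #⇔<⊎> (HCRProperties.1#0 heytingCommutativeRing)
  ... | inj₂ 0<1# = 0<1#
  ... | inj₁ 1<0  = <-respʳ-≈ -1*-1≈1 (*-pos 0<-1 0<-1)
    where
    0<-1 : 0# < - 1#
    0<-1 = <-respʳ-≈ (+-identityˡ (- 1#))
             (<-respˡ-≈ (-‿inverseʳ 1#) (+-monoˡ-< (- 1#) 1<0))
    -1*-1≈1 : - 1# * - 1# ≈ 1#
    -1*-1≈1 = trans (sym (-‿distribˡ-* 1# (- 1#)))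
                (trans (-‿cong (*-identityˡ (- 1#))) (-‿involutive 1#))

  0<m+x : ∀ m {x} → 0# < x → 0# < fromℕ m + x
  0<m+x zero    {x} 0<x = <-respʳ-≈ (sym (+-identityˡ x)) 0<x
  0<m+x (suc m) {x} 0<x = <-trans 0<1
    (<-respʳ-≈ (trans (+-comm _ 1#) (sym (+-assoc 1# (fromℕ m) x)))
      (<-respˡ-≈ (+-identityˡ 1#) (+-monoˡ-< 1# (0<m+x m 0<x))))

  0<j-1+x : ∀ j .{{_ : NonZero j}} {x} → 0# < x → 0# < fromℕ j - 1# + x
  0<j-1+x (suc m) {x} 0<x = <-respʳ-≈ (+-congʳ (sym 1+m-1≈m)) (0<m+x m 0<x)
    where
    1+m-1≈m : 1# + fromℕ m - 1# ≈ fromℕ m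
    1+m-1≈m = trans (+-congʳ (+-comm 1# (fromℕ m)))
                (trans (+-assoc (fromℕ m) 1# (- 1#))
                  (trans (+-congˡ (-‿inverseʳ 1#)) (+-identityʳ (fromℕ m))))

ε : ℕ → ℕ
ε n with parity n
... | 0ℙ = 2
... | 1ℙ = 1

index-nonZero : ∀ n (i : Fin (⌈ n /2⌉ ℕ.∸ 1)) → NonZero (n ℕ.∸ 2 ℕ.* suc (toℕ i))
index-nonZero n i =
  ℕ.>-nonZero (ℕ.m<n⇒0<n∸m (bound n (suc (toℕ i)) (lift ⌈ n /2⌉ (toℕ<n i))))
  where
  lift : ∀ x {k} → k ℕ.< x ℕ.∸ 1 → suc k ℕ.< x
  lift (suc x) k<x = ℕ.s<s k<x

  bound : ∀ n k → k ℕ.< ⌈ n /2⌉ → 2 ℕ.* k ℕ.< n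
  bound (suc n)       zero    _         = ℕ.z<s
  bound (suc zero)    (suc k) (ℕ.s≤s ())
  bound (suc (suc n)) (suc k) 1+k<⌈n/2⌉ =
    ≡.subst (ℕ._< suc (suc n)) (≡.sym (ℕ.*-suc 2 k))
      (ℕ.s<s (ℕ.s<s (bound n k (ℕ.s<s⁻¹ 1+k<⌈n/2⌉))))

module _ {c ℓ₁ ℓ₂ ℓ₃} (R : RealField c ℓ₁ ℓ₂ ℓ₃) where
  open RealField R

  module _ {z₁ z₂ : Carrier} (0<z₁ : 0# < z₁) (0<z₂ : 0# < z₂) where

    G : (j : ℕ) .{{_ : NonZero j}} → Carrier
    G j = (fromℕ j + z₁ * z₂) / (fromℕ j - 1# + z₁ * z₂)
            ⟨ 0<⇒#0 R (0<j-1+x R j (*-pos 0<z₁ 0<z₂)) ⟩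

    -- The product over 1 ≤ k ≤ ⌈n/2⌉ - 1 of G (n - 2k), with k = i + 1 for
    -- i : Fin (⌈n/2⌉ - 1).  All the subtractions n - 2k involved are positive.
    ∏G : ℕ → Carrier
    ∏G n = ∏ {⌈ n /2⌉ ℕ.∸ 1} λ i →
      G (n ℕ.∸ 2 ℕ.* suc (toℕ i)) {{index-nonZero n i}}

-- The product telescopes to Γ (n + 2) = Γ n G(n), and the numerator of G(n) is the denominator
-- of G(n + 1), so by induction Γ n Γ (n + 1) = n - 1 + z₁ z₂ for every n ≥ 1.  Consecutive
-- products therefore differ by 1, and dividing Γ (n + 1) Γ (n + 2) = 1 + Γ n Γ (n + 1) by
-- Γ (n + 1) gives the recurrence.

module Submission where

open import Defs
open import Algebra.Apartness.Bundles using (HeytingCommutativeRing)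
open import Algebra.Bundles using (CommutativeRing)
import Algebra.Apartness.Properties.HeytingCommutativeRing as HCRProperties
import Algebra.Properties.CommutativeSemigroup as CommutativeSemigroupProperties
import Algebra.Properties.Monoid.Sum as MonoidSum
open import Data.Fin.Base using (toℕ; suc)
open import Data.Nat.Base as ℕ using (ℕ; zero; suc; NonZero; z≤n; s≤s)
import Data.Nat.Properties as ℕ
open import Data.Product.Base using (∃-syntax; _,_; proj₁; proj₂)
open import Relation.Binary.PropositionalEquality.Core as ≡ using (_≡_)
import Relation.Binary.Reasoning.Setoid as ≈-Reasoning

module _ {c ℓ₁ ℓ₂ ℓ₃} (R : RealField c ℓ₁ ℓ₂ ℓ₃) where
  open RealField R
  open HCRProperties heytingCommutativeRing using (x-0≈x; invertibleˡ⇒#; #-congʳ)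
  open CommutativeRing (HeytingCommutativeRing.commutativeRing heytingCommutativeRing)
    using (*-monoid; *-commutativeSemigroup; +-commutativeSemigroup)
  open CommutativeSemigroupProperties *-commutativeSemigroup
    using (x∙yz≈y∙xz; x∙yz≈yx∙z; x∙yz≈zy∙x)
  open CommutativeSemigroupProperties +-commutativeSemigroup
    using () renaming (xy∙z≈y∙xz to [x+y]+z≈y+[x+z])
  open MonoidSum *-monoid using () renaming (sum-cong-≋ to ∏-cong)
  open ≈-Reasoning setoid

  *-inverseʳ-#0 : ∀ {y} (y#0 : y # 0#) → y * proj₁ (#⇒invertible y#0) ≈ 1#
  *-inverseʳ-#0 {y} y#0 =
    trans (*-congʳ (sym (x-0≈x y))) (proj₂ (proj₂ (#⇒invertible y#0)))

  y*[x/y]≈x : ∀ x {y} (y#0 : y # 0#) → y * (x / y ⟨ y#0 ⟩) ≈ x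
  y*[x/y]≈x x {y} y#0 = begin
    y * (x / y ⟨ y#0 ⟩)                ≈⟨ x∙yz≈y∙xz y x _ ⟩
    x * (y * proj₁ (#⇒invertible y#0)) ≈⟨ *-congˡ (*-inverseʳ-#0 y#0) ⟩
    x * 1#                             ≈⟨ *-identityʳ x ⟩
    x                                  ∎

  *-cancelˡ-#0 : ∀ {x y z} → x # 0# → x * y ≈ x * z → y ≈ z
  *-cancelˡ-#0 {x} {y} {z} x#0 xy≈xz = begin
    y             ≈⟨ x⁻¹xw≈w y ⟨
    x⁻¹ * (x * y) ≈⟨ *-congˡ xy≈xz ⟩
    x⁻¹ * (x * z) ≈⟨ x⁻¹xw≈w z ⟩
    z             ∎
    where
    x⁻¹ = proj₁ (#⇒invertible x#0)
    x⁻¹xw≈w : ∀ w → x⁻¹ * (x * w) ≈ w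
    x⁻¹xw≈w w = begin
      x⁻¹ * (x * w) ≈⟨ x∙yz≈yx∙z x⁻¹ x w ⟩
      x * x⁻¹ * w   ≈⟨ *-congʳ (*-inverseʳ-#0 x#0) ⟩
      1# * w        ≈⟨ *-identityˡ w ⟩
      w             ∎

  -- If `w` inverts `x * y`, then `w * x` is a left inverse of `y`. This makes a single `Γ` term
  -- invertible once a product containing it is known.
  xy#0⇒y#0 : ∀ {x y} → x * y # 0# → y # 0#
  xy#0⇒y#0 {x} {y} xy#0 = invertibleˡ⇒# (w * x , (begin
    w * x * (y - 0#) ≈⟨ *-congˡ (x-0≈x y) ⟩
    w * x * y        ≈⟨ *-assoc w x y ⟩
    w * (x * y)      ≈⟨ *-comm w (x * y) ⟩
    x * y * w        ≈⟨ *-inverseʳ-#0 xy#0 ⟩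
    1#               ∎))
    where
    w = proj₁ (#⇒invertible xy#0)

  -- To be used with three consecutive terms of `Γ` as `x`, `y`, `z`. Both sides agree after
  -- multiplication by `y`, which can be cancelled.
  yz≈1+xy⇒z≈1/y+x : ∀ {x y z} (y#0 : y # 0#) → y * z ≈ 1# + x * y →
                    z ≈ 1# / y ⟨ y#0 ⟩ + x
  yz≈1+xy⇒z≈1/y+x {x} {y} {z} y#0 yz≈1+xy = *-cancelˡ-#0 y#0 (begin
    y * z                            ≈⟨ yz≈1+xy ⟩
    1# + x * y                       ≈⟨ +-cong (sym (y*[x/y]≈x 1# y#0)) (*-comm x y) ⟩
    y * (1# / y ⟨ y#0 ⟩) + y * x     ≈⟨ distribˡ y _ x ⟨
    y * (1# / y ⟨ y#0 ⟩ + x)         ∎)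

  fromℕ-suc-1 : ∀ n x → fromℕ (suc n) - 1# + x ≈ fromℕ n + x
  fromℕ-suc-1 n x = +-congʳ (begin
    1# + fromℕ n - 1#     ≈⟨ [x+y]+z≈y+[x+z] 1# (fromℕ n) (- 1#) ⟩
    fromℕ n + (1# - 1#)   ≈⟨ +-congˡ (-‿inverseʳ 1#) ⟩
    fromℕ n + 0#          ≈⟨ +-identityʳ (fromℕ n) ⟩
    fromℕ n               ∎)

  module _ {z₁ z₂ : Carrier} (0<z₁ : 0# < z₁) (0<z₂ : 0# < z₂) where

    -- The `NonZero` arguments are irrelevant, so equal indices suffice even when their nonzeroness
    -- is proved differently.
    G-cong : ∀ {j k} .{{_ : NonZero j}} .{{_ : NonZero k}} → j ≡ k →
             G R 0<z₁ 0<z₂ j ≈ G R 0<z₁ 0<z₂ k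
    G-cong ≡.refl = refl

    -- Adding 2 to the index adds one factor, and the new one is that of `k = 1`. Each later factor
    -- `k + 1` matches the old factor `k`, as `(3 + n) - 2(k + 1) = (1 + n) - 2k`.
    ∏G-step : ∀ n → ∏G R 0<z₁ 0<z₂ (3 ℕ.+ n) ≈
                    G R 0<z₁ 0<z₂ (suc n) * ∏G R 0<z₁ 0<z₂ (suc n)
    ∏G-step n = *-congˡ (∏-cong λ i →
      G-cong {{index-nonZero (3 ℕ.+ n) (suc i)}} {{index-nonZero (suc n) i}}
        (≡.cong (3 ℕ.+ n ℕ.∸_) (ℕ.*-suc 2 (suc (toℕ i)))))

    fromℕ*G : ∀ n → (fromℕ n + z₁ * z₂) * G R 0<z₁ 0<z₂ (suc n) ≈ fromℕ (suc n) + z₁ * z₂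
    fromℕ*G n = trans (*-congʳ (sym (fromℕ-suc-1 n _))) (y*[x/y]≈x _ _)

    module _ (Γ : ℕ → Carrier) (Γ1≈z₁ : Γ 1 ≈ z₁) (Γ2≈z₂ : Γ 2 ≈ z₂)
      (Γ-∏ : ∀ n → n ℕ.≥ 3 → Γ n ≈ Γ (ε n) * ∏G R 0<z₁ 0<z₂ n) where

      -- At indices 1 and 2 the product is empty, so the formula extends to every positive index and
      -- telescoping can start there.
      Γ-∏⁺ : ∀ n → Γ (suc n) ≈ Γ (ε (suc n)) * ∏G R 0<z₁ 0<z₂ (suc n)
      Γ-∏⁺ 0             = sym (*-identityʳ (Γ 1))
      Γ-∏⁺ 1             = sym (*-identityʳ (Γ 2))
      Γ-∏⁺ (suc (suc n)) = Γ-∏ (3 ℕ.+ n) (s≤s (s≤s (s≤s z≤n)))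

      Γ-step : ∀ n → Γ (3 ℕ.+ n) ≈ G R 0<z₁ 0<z₂ (suc n) * Γ (suc n)
      Γ-step n = begin
        Γ (3 ℕ.+ n)                    ≈⟨ Γ-∏⁺ (2 ℕ.+ n) ⟩
        Γε * ∏G R 0<z₁ 0<z₂ (3 ℕ.+ n)  ≈⟨ *-congˡ (∏G-step n) ⟩
        Γε * (g * p)                   ≈⟨ x∙yz≈y∙xz Γε g p ⟩
        g * (Γε * p)                   ≈⟨ *-congˡ (Γ-∏⁺ n) ⟨
        g * Γ (suc n)                  ∎
        where
        -- `parity` discards two successors by computation, so this is also the prefactor of
        -- `Γ (3 + n)`.
        Γε = Γ (ε (suc n))
        g  = G R 0<z₁ 0<z₂ (suc n)
        p  = ∏G R 0<z₁ 0<z₂ (suc n)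

      Γ*Γ : ∀ n → Γ (suc n) * Γ (2 ℕ.+ n) ≈ fromℕ n + z₁ * z₂
      Γ*Γ zero    = trans (*-cong Γ1≈z₁ Γ2≈z₂) (sym (+-identityˡ _))
      Γ*Γ (suc n) = begin
        Γ (2 ℕ.+ n) * Γ (3 ℕ.+ n)        ≈⟨ *-congˡ (Γ-step n) ⟩
        Γ (2 ℕ.+ n) * (g * Γ (suc n))    ≈⟨ x∙yz≈y∙xz _ g _ ⟩
        g * (Γ (2 ℕ.+ n) * Γ (suc n))    ≈⟨ x∙yz≈zy∙x g _ _ ⟩
        Γ (suc n) * Γ (2 ℕ.+ n) * g      ≈⟨ *-congʳ (Γ*Γ n) ⟩
        (fromℕ n + z₁ * z₂) * g          ≈⟨ fromℕ*G n ⟩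
        fromℕ (suc n) + z₁ * z₂          ∎
        where
        g = G R 0<z₁ 0<z₂ (suc n)

      -- The product of this term with its predecessor is `fromℕ n + z₁ * z₂`, which is positive and
      -- hence apart from 0; the sign of the term itself is never examined.
      Γ#0 : ∀ n → Γ (2 ℕ.+ n) # 0#
      Γ#0 n = xy#0⇒y#0 (#-congʳ (sym (Γ*Γ n)) (0<⇒#0 R (0<m+x R n (*-pos 0<z₁ 0<z₂))))

      Γ*Γ-suc : ∀ n → Γ (2 ℕ.+ n) * Γ (3 ℕ.+ n) ≈ 1# + Γ (suc n) * Γ (2 ℕ.+ n)
      Γ*Γ-suc n = begin
        Γ (2 ℕ.+ n) * Γ (3 ℕ.+ n)       ≈⟨ Γ*Γ (suc n) ⟩
        -- `fromℕ (suc n)` unfolds to `1# + fromℕ n`, which exposes the difference of 1.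
        1# + fromℕ n + z₁ * z₂          ≈⟨ +-assoc 1# (fromℕ n) _ ⟩
        1# + (fromℕ n + z₁ * z₂)        ≈⟨ +-congˡ (Γ*Γ n) ⟨
        1# + Γ (suc n) * Γ (2 ℕ.+ n)    ∎

proposition1p2 : ∀ {c ℓ₁ ℓ₂ ℓ₃} (R : RealField c ℓ₁ ℓ₂ ℓ₃) →
    let open RealField R in
    (z₁ z₂ : Carrier) (0<z₁ : 0# < z₁) (0<z₂ : 0# < z₂)
    (Γ : ℕ → Carrier) →
    Γ 1 ≈ z₁ →
    Γ 2 ≈ z₂ →
    (∀ n → n ℕ.≥ 3 → Γ n ≈ Γ (ε n) * ∏G R 0<z₁ 0<z₂ n) →
    ∀ n → n ℕ.≥ 3 →
    ∃[ Γₙ₋₁#0 ] Γ n ≈ 1# / Γ (n ℕ.∸ 1) ⟨ Γₙ₋₁#0 ⟩ + Γ (n ℕ.∸ 2)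
proposition1p2 R z₁ z₂ 0<z₁ 0<z₂ Γ Γ1≈z₁ Γ2≈z₂ Γ-∏ (suc (suc (suc n))) (s≤s (s≤s (s≤s z≤n))) =
  -- After the match the divisor is `Γ (2 + n)` and the summand is `Γ (suc n)`.
  Γ#0 R 0<z₁ 0<z₂ Γ Γ1≈z₁ Γ2≈z₂ Γ-∏ n ,
  yz≈1+xy⇒z≈1/y+x R _ (Γ*Γ-suc R 0<z₁ 0<z₂ Γ Γ1≈z₁ Γ2≈z₂ Γ-∏ n)
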